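{- Let $G$ be a finite graph. Every relation $R\subseteq V_G\times V_G$ satisfying $G\ast R=G$ is an automorphism of $G$ if and only if $G$ has property N.
   Context: Graphs are finite and undirected, loops allowed. For a finite set $B$ and a relation $R\subseteq V_G\times B$ with full image (every $b\in B$ has some $v\in V_G$ with $(v,b)\in R$), $G\ast R$ is the graph with vertex set $B$ and edge set $\{(a,b)\in B\times B: \exists (u,v)\in E_G,\ (u,a)\in R,\ (v,b)\in R\}$; the equation $G\ast R=G$ presupposes that $R$ has full image. A relation $R$ is called an automorphism of $G$ if $R=\{(x,f(x)): x\in V_G\}$ for a graph automorphism $f$ of $G$. $N_G(x)$ is the set of vertices adjacent to $x$. $G$ has property N if for all $x,y\in V_G$, $N_G(x)\subseteq N_G(y)$ implies $x=y$. -}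

module Defs where

open import Level using (0ℓ)
open import Data.Fin.Base using (Fin)
open import Data.Product.Base using (∃₂; ∃-syntax; _×_; _,_)
open import Function.Bundles using (_↔_)
open import Function.Definitions using (Bijective)
open import Relation.Binary.Core using (Rel; REL; _⇔_)
open import Relation.Binary.Definitions using (Symmetric)
open import Relation.Binary.PropositionalEquality.Core using (_≡_)
open import Relation.Unary using (Pred; _⊆_)

Finite : Set → Set
Finite V = ∃[ n ] (V ↔ Fin n)

-- Neither edge sets nor the relations R below are assumed decidable.
-- Finiteness of V is a separate hypothesis of the theorem.
record Graph (V : Set) : Set₁ where
  field
    Edge     : Rel V 0ℓ
    Edge-sym : Symmetric Edge

open Graph public

infix 4 _≈_
_≈_ : ∀ {V} → Graph V → Graph V → Set
G ≈ H = Edge G ⇔ Edge H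

FullImage : ∀ {V B : Set} → REL V B 0ℓ → Set
FullImage R = ∀ b → ∃[ v ] R v b

-- This is defined for every R; full image is required in Fixes.
infixl 7 _∗_
_∗_ : ∀ {V B} → Graph V → REL V B 0ℓ → Graph B
(G ∗ R) .Edge a b = ∃₂ λ u v → Edge G u v × R u a × R v b
(G ∗ R) .Edge-sym (u , v , e , p , q) = v , u , Edge-sym G e , q , p

Fixes : ∀ {V} → Graph V → Rel V 0ℓ → Set
Fixes G R = FullImage R × G ∗ R ≈ G

IsGraphAutomorphism : ∀ {V} → Graph V → (V → V) → Set
IsGraphAutomorphism G f =
  Bijective _≡_ _≡_ f × (Edge G ⇔ λ x y → Edge G (f x) (f y))

IsAutomorphism : ∀ {V} → Graph V → Rel V 0ℓ → Set
IsAutomorphism G R =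
  ∃[ f ] IsGraphAutomorphism G f × (R ⇔ λ x y → y ≡ f x)

N[_] : ∀ {V} → Graph V → V → Pred V 0ℓ
N[ G ] x = λ y → Edge G x y

PropertyN : ∀ {V} → Graph V → Set
PropertyN G = ∀ x y → N[ G ] x ⊆ N[ G ] y → x ≡ y

{-# OPTIONS --safe #-}

-- If N(x) ⊆ N(y), then the identity relation enlarged by the pair (x , y)
-- fixes G; it can only be an automorphism when x = y.
--
-- Conversely, let G ∗ R = G.  Then G ∗ Rᵏ = G for all k, and by finiteness
-- Rⁱ = Rⁱ⁺ᵖ for some i and some p > 0.  If u v is an edge and Rᵖ v w, lift u v
-- along Rⁱ to an edge s t; then Rⁱ s u and Rⁱ⁺ᵖ t w, hence Rⁱ t w, so u w is
-- an edge.  Thus Rᵖ v w implies N(v) ⊆ N(w), and property N yields Rᵖ ⊆ id.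
-- Since R has full image this makes R a permutation.  Constructively the
-- period p exists only up to double negation, which suffices because equality
-- on a finite set is decidable.
module Submission where

open import Defs
open import Level using (0ℓ)
open import Function.Bundles using (_⇔_)
open import Relation.Binary.Core using (Rel)

open import Data.Bool.Base using (if_then_else_)
open import Data.Fin.Base using (Fin; toℕ; funToFin; finToFun)
open import Data.Fin.Patterns using (0F; 1F)
open import Data.Fin.Properties
  using (pigeonhole; finToFun-funToFin; sequence; inj⇒≟; any?; *↔×)
open import Data.Nat.Base using (ℕ; zero; suc; _+_; _^_; _<_)
open import Data.Nat.Properties using (m≤n⇒∃[o]m+o≡n; n<1+n; +-suc)
open import Data.Product.Base
  using (∃; ∃-syntax; ∃₂; _×_; _,_; proj₁; proj₂; uncurry)
open import Data.Product.Function.NonDependent.Propositional using (_×-↔_)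
open import Data.Sum.Base using (_⊎_; inj₁; inj₂)
open import Effect.Monad using (RawMonad)
open import Function.Base using (_∘_)
open import Function.Bundles using (Inverse; mk⇔)
open import Function.Construct.Composition using (_↔-∘_)
open import Function.Construct.Symmetry using (↔-sym)
open import Function.Properties.Inverse using (Inverse⇒Injection)
open import Relation.Binary.Construct.Composition using (_;_)
open import Relation.Binary.Core using (_⇒_)
open import Relation.Binary.Definitions using (DecidableEquality)
open import Relation.Binary.PropositionalEquality
  using (_≡_; refl; sym; trans; cong; subst; module ≡-Reasoning)
open import Relation.Nullary using (¬_; Dec; yes; no; does)
open import Relation.Nullary.Decidable
  using (map′; decidable-stable; ¬¬-excluded-middle)
open import Relation.Nullary.Negation using (¬¬-map; ¬¬-Monad)
open import Relation.Unary using (Pred; _≐_)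

private
  variable
    A B V : Set

finite-≟ : Finite A → DecidableEquality A
finite-≟ (_ , A↔n) = inj⇒≟ (Inverse⇒Injection A↔n)

finite-× : Finite A → Finite B → Finite (A × B)
finite-× (_ , A↔m) (_ , B↔n) = _ , (↔-sym *↔× ↔-∘ (A↔m ×-↔ B↔n))

finite-any? : Finite A → {P : Pred A 0ℓ} → (∀ x → Dec (P x)) → Dec (∃ P)
finite-any? (_ , A↔n) {P} P? =
  map′ (λ (i , p) → from i , p)
       (λ (x , p) → to x , subst P (sym (strictlyInverseʳ x)) p)
       (any? (P? ∘ from))
  where open Inverse A↔n

indicator : Dec A → Fin 2
indicator a? = if does a? then 1F else 0F

indicator-transport : (a? : Dec A) (b? : Dec B) → indicator a? ≡ indicator b? → A → B
indicator-transport _       (yes b) _  _ = b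
indicator-transport (yes _) (no _)  ()
indicator-transport (no ¬a) (no _)  _  a with () ← ¬a a

-- A set with n elements has 2ⁿ subsets.
repeated-predicate : Finite A → (P : ℕ → Pred A 0ℓ) →
  ¬ ¬ (∃₂ λ i j → i < j × P i ≐ P j)
-- Double negation commutes with finite conjunctions, so the membership questions for the first
-- `2 ^ n + 1` predicates may all be taken as decided at once.
repeated-predicate {A} (n , A↔n) P = ¬¬-map repeat (sequence ¬¬-app λ k →
    sequence ¬¬-app λ i → ¬¬-excluded-middle)
  where
  open Inverse A↔n
  ¬¬-app = RawMonad.rawApplicative (¬¬-Monad {a = 0ℓ})

  repeat : (∀ (k : Fin (suc (2 ^ n))) i → Dec (P (toℕ k) (from i))) →
           ∃₂ λ i j → i < j × P i ≐ P j
  repeat P? =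
    let k , l , k<l , eq = pigeonhole (n<1+n (2 ^ n)) code
    in toℕ k , toℕ l , k<l , transport k l eq , transport l k (sym eq)
    where
    code : Fin (suc (2 ^ n)) → Fin (2 ^ n)
    code k = funToFin (indicator ∘ P? k)

    indicator-≡ : ∀ k l → code k ≡ code l → ∀ i →
                  indicator (P? k i) ≡ indicator (P? l i)
    indicator-≡ k l eq i = begin
      indicator (P? k i)     ≡⟨ finToFun-funToFin (indicator ∘ P? k) i ⟨
      finToFun (code k) i    ≡⟨ cong (λ c → finToFun c i) eq ⟩
      finToFun (code l) i    ≡⟨ finToFun-funToFin (indicator ∘ P? l) i ⟩
      indicator (P? l i)     ∎
      where open ≡-Reasoning

    transport : ∀ k l → code k ≡ code l → ∀ {x} → P (toℕ k) x → P (toℕ l) x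
    transport k l eq {x} p = subst (P (toℕ l)) (strictlyInverseʳ x)
      (indicator-transport (P? k (to x)) (P? l (to x)) (indicator-≡ k l eq (to x))
        (subst (P (toℕ k)) (sym (strictlyInverseʳ x)) p))

infixr 10 _^^_
_^^_ : Rel V 0ℓ → ℕ → Rel V 0ℓ
R ^^ zero  = _≡_
R ^^ suc k = R ; (R ^^ k)

module _ {R : Rel V 0ℓ} where

  ^^-+ : ∀ m {n} → ((R ^^ m) ; (R ^^ n)) ⇒ (R ^^ (m + n))
  ^^-+ zero    (_ , refl , q)        = q
  ^^-+ (suc m) (y , (z , r , p) , q) = z , r , ^^-+ m (y , p , q)

  ^^-snoc : ∀ k → ((R ^^ k) ; R) ⇒ (R ^^ suc k)
  ^^-snoc zero    (y , refl , r)        = _ , r , refl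
  ^^-snoc (suc k) (y , (z , r , p) , q) = z , r , ^^-snoc k (y , p , q)

  ^^-fullImage : FullImage R → ∀ k → FullImage (R ^^ k)
  ^^-fullImage full zero    b = b , refl
  ^^-fullImage full (suc k) b =
    let y , p = ^^-fullImage full k b
        x , r = full y
    in x , y , r , p

  module _ (G : Graph V) (G∗R≈G : G ∗ R ≈ G) where

    -- Acting by a composite is acting twice: `G ∗ (R ; S)` and `(G ∗ R) ∗ S` have the same edges.
    ∗-^^ : ∀ k → G ∗ (R ^^ k) ≈ G
    ∗-^^ zero = (λ { (_ , _ , e , refl , refl) → e }) ,
                (λ e → _ , _ , e , refl , refl)
    ∗-^^ (suc k) =
      (λ { (u , v , e , (a , r , p) , (b , s , q)) →
           proj₁ (∗-^^ k) (a , b , proj₁ G∗R≈G (u , v , e , r , s) , p , q) }) ,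
      (λ e → let a , b , e′ , p , q = proj₂ (∗-^^ k) e
                 u , v , e″ , r , s = proj₂ G∗R≈G e′
             in u , v , e″ , (a , r , p) , (b , s , q))

    edge-absorbs-period : ∀ i p → (R ^^ (i + p)) ⇒ (R ^^ i) →
      (Edge G ; (R ^^ p)) ⇒ Edge G
    edge-absorbs-period i p shrink (v , e , q) =
      let s , t , e′ , su , tv = proj₂ (∗-^^ i) e
      in proj₁ (∗-^^ i) (s , t , e′ , su , shrink (^^-+ i (v , tv , q)))

fixes⇒period : Finite V → (G : Graph V) → PropertyN G →
  {R : Rel V 0ℓ} → Fixes G R → ¬ ¬ (∃[ k ] ((R ^^ suc k) ⇒ _≡_))
fixes⇒period fin G N {R} (_ , G∗R≈G) =
  -- Each power of `R` counts as a subset of the finite set `V × V`.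
  ¬¬-map period (repeated-predicate (finite-× fin fin) (λ k → uncurry (R ^^ k)))
  where
  period : (∃₂ λ i j → i < j × uncurry (R ^^ i) ≐ uncurry (R ^^ j)) →
           ∃[ k ] ((R ^^ suc k) ⇒ _≡_)
  -- `i < j` means `suc i ≤ j`, so `j` is `suc i + k` and the period `suc k` is positive. Absorption
  -- acts on the second endpoint of an edge, hence the two uses of `Edge-sym`.
  period (i , j , i<j , _ , shrink) with k , refl ← m≤n⇒∃[o]m+o≡n i<j =
    k , λ {v} {w} q → N v w λ e → Edge-sym G
      (edge-absorbs-period G G∗R≈G i (suc k)
        (λ {x} {y} r → shrink (subst (λ m → (R ^^ m) x y) (+-suc i k) r))
        (v , Edge-sym G e , q))

module _ {R : Rel V 0ℓ} (full : FullImage R) {k : ℕ} (period : (R ^^ suc k) ⇒ _≡_) where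

  -- Full image gives some `z` that reaches `x` in `k` steps. One more step leads to `y`, so the
  -- period forces `z ≡ y`. Two arrows with a common source or target are then compared by closing
  -- one of them into a cycle.
  period-reverse : ∀ {x y} → R x y → (R ^^ k) y x
  period-reverse {x} {y} r =
    let z , p = ^^-fullImage full k x
    in subst (λ z → (R ^^ k) z x) (period (^^-snoc k (x , p , r))) p

  period⇒functional : ∀ {x y y′} → R x y → R x y′ → y ≡ y′
  period⇒functional r r′ = period (^^-snoc k (_ , period-reverse r , r′))

  period⇒injective : ∀ {x x′ y} → R x y → R x′ y → x ≡ x′
  period⇒injective r r′ = period (_ , r , period-reverse r′)

  period⇒total : ∀ x → ∃[ y ] R x y
  period⇒total x with ^^-fullImage full (suc k) x
  -- The chain ends in `x`, so by the period it also starts there, and its first step yields an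
  -- image of `x`.
  ... | z , y , r , p = y , subst (λ z → R z y) (period (y , r , p)) r

module _ (G : Graph V) {R : Rel V 0ℓ} (fixes : Fixes G R)
         (functional : ∀ {x y y′} → R x y → R x y′ → y ≡ y′)
         (injective : ∀ {x x′ y} → R x y → R x′ y → x ≡ x′)
         (total : ∀ x → ∃[ y ] R x y) where

  permutation⇒automorphism : IsAutomorphism G R
  permutation⇒automorphism =
    f , ((f-injective , f-surjective) , preserves , reflects) , R⇒f , f⇒R
    where
    f : V → V
    f = proj₁ ∘ total

    R-f : ∀ x → R x (f x)
    R-f = proj₂ ∘ total

    R⇒f : ∀ {x y} → R x y → y ≡ f x
    R⇒f r = functional r (R-f _)

    f⇒R : ∀ {x y} → y ≡ f x → R x y
    f⇒R refl = R-f _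

    f-injective : ∀ {x y} → f x ≡ f y → x ≡ y
    f-injective eq = injective (R-f _) (f⇒R eq)

    f-surjective : ∀ y → ∃[ x ] (∀ {z} → z ≡ x → f z ≡ y)
    f-surjective y =
      let x , r = proj₁ fixes y in x , λ { refl → sym (R⇒f r) }

    preserves : ∀ {x y} → Edge G x y → Edge G (f x) (f y)
    preserves e = proj₁ (proj₂ fixes) (_ , _ , e , R-f _ , R-f _)

    reflects : ∀ {x y} → Edge G (f x) (f y) → Edge G x y
    reflects {x} {y} e with proj₂ (proj₂ fixes) e
    -- The edge lifts along `R`, and injectivity leaves only `x` and `y` as the endpoints of the
    -- lift.
    ... | u , v , e′ , r , s
      with refl ← injective r (R-f x)
         | refl ← injective s (R-f y) = e′

module _ (fin : Finite V) (G : Graph V) (N : PropertyN G)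
         {R : Rel V 0ℓ} (fixes : Fixes G R) where

  private
    _≟_ = finite-≟ fin
    full = proj₁ fixes

    -- A doubly negated period can only serve decidable goals: here, equality of vertices and a
    -- search over `V`.
    by-period : Dec A → ((∃[ k ] ((R ^^ suc k) ⇒ _≡_)) → A) → A
    by-period a? f = decidable-stable a? (¬¬-map f (fixes⇒period fin G N fixes))

  fixes⇒functional : ∀ {x y y′} → R x y → R x y′ → y ≡ y′
  fixes⇒functional {y = y} {y′} r r′ =
    by-period (y ≟ y′) λ (k , period) → period⇒functional full {k} period r r′

  fixes⇒injective : ∀ {x x′ y} → R x y → R x′ y → x ≡ x′
  fixes⇒injective {x} {x′} r r′ =
    by-period (x ≟ x′) λ (k , period) → period⇒injective full {k} period r r′

  -- R is not decidable, so an image of x is searched for through the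
  -- choice of preimages contained in full.
  fixes⇒total : ∀ x → ∃[ y ] R x y
  fixes⇒total x =
    let y , eq = by-period (finite-any? fin λ y → proj₁ (full y) ≟ x)
          -- An image `y` of `x` has no preimage other than `x`, so the preimage chosen by `full y`
          -- is `x`.
          λ (k , period) → let y , r = period⇒total full {k} period x
                           in y , fixes⇒injective (proj₂ (full y)) r
    in y , subst (λ z → R z y) eq (proj₂ (full y))

  fixes⇒automorphism : IsAutomorphism G R
  fixes⇒automorphism =
    permutation⇒automorphism G fixes fixes⇒functional fixes⇒injective fixes⇒total

module _ (G : Graph V) {x y : V} (Nx⊆Ny : ∀ {z} → Edge G x z → Edge G y z) where

  IdWith : Rel V 0ℓ
  IdWith u a = u ≡ a ⊎ (u ≡ x × a ≡ y)

  -- `IdWith` moves a vertex only to one with at least the same neighbours. For `idWith-fixes` the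
  -- two endpoints are moved one after the other.
  edge-transport : ∀ {u a z} → IdWith u a → Edge G u z → Edge G a z
  edge-transport (inj₁ refl)          e = e
  edge-transport (inj₂ (refl , refl)) e = Nx⊆Ny e

  idWith-fixes : Fixes G IdWith
  idWith-fixes = (λ b → b , inj₁ refl) ,
    (λ { (u , v , e , p , q) →
         Edge-sym G (edge-transport q (Edge-sym G (edge-transport p e))) }) ,
    (λ e → _ , _ , e , inj₁ refl , inj₁ refl)

automorphisms⇒propertyN : (G : Graph V) →
  (∀ R → Fixes G R → IsAutomorphism G R) → PropertyN G
automorphisms⇒propertyN G auto x y Nx⊆Ny
  with _ , _ , R⇒f , _ ← auto (IdWith G Nx⊆Ny) (idWith-fixes G Nx⊆Ny) =
  -- `x` is related to both `x` and `y`, so both equal the value of the automorphism at `x`.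
  trans (R⇒f (inj₁ refl)) (sym (R⇒f (inj₂ (refl , refl))))

theorem4p3p7 : (V : Set) → Finite V → (G : Graph V) →
    (∀ (R : Rel V 0ℓ) → Fixes G R → IsAutomorphism G R) ⇔ PropertyN G
theorem4p3p7 V fin G =
  mk⇔ (automorphisms⇒propertyN G) (λ N R fixes → fixes⇒automorphism fin G N fixes)
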